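{- Let $D=(E,\mathcal{F})$ be a delta-matroid, $A\subseteq E$, and $\overline{A}=E-A$. Then $D*A$ has width one if and only if $A$ is a separator of $D_{\min}$, and one of $D|A$ and $D|\overline{A}$ is a matroid and the other has width one.
   Context: A delta-matroid $D=(E,\mathcal{F})$ consists of a finite set $E$ (the ground set) and a non-empty set $\mathcal{F}$ of subsets of $E$ (the feasible sets) satisfying the Symmetric Exchange Axiom: for all $X,Y\in\mathcal{F}$ and every $u\in X\triangle Y$ there is $v\in X\triangle Y$ (possibly $v=u$) with $X\triangle\{u,v\}\in\mathcal{F}$. Here $\triangle$ denotes symmetric difference. A matroid is a delta-matroid whose feasible sets all have the same size; its feasible sets are then its bases. The width of $D$ is $w(D)=\max_{F\in\mathcal{F}}|F|-\min_{F\in\mathcal{F}}|F|$. For $A\subseteq E$, the twist of $D$ with respect to $A$ is the delta-matroid $D*A=(E,\{A\triangle F: F\in\mathcal{F}\})$. $D_{\min}=(E,\mathcal{F}_{\min})$, where $\mathcal{F}_{\min}$ is the set of feasible sets of $D$ of minimum size; it is a matroid. For a matroid $M$ on $E$ with rank function $r$ ($r(X)$ is the size of the largest intersection of $X$ with a basis of $M$), a set $A\subseteq E$ is a separator of $M$ if $A$ is a union of components of $M$; equivalently $r(A)+r(E-A)=r(E)$. Both $\emptyset$ and $E$ are separators. Deletion and contraction: an element $e$ is a coloop of $D$ if it is in every feasible set and a loop if it is in no feasible set. If $e$ is not a coloop, $D\setminus e=(E-e,\{F: F\in\mathcal{F}, F\subseteq E-e\})$. If $e$ is not a loop, $D/e=(E-e,\{F-e: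 F\in\mathcal{F}, e\in F\})$. If $e$ is a loop or coloop, then $D/e=D\setminus e$. The result of a sequence of deletions and contractions does not depend on the order. The restriction $D|A$ is obtained from $D$ by deleting all elements of $E-A$. -}

module Defs where

open import Data.Bool using (_xor_)
open import Data.Fin using (Fin)
open import Data.Fin.Subset
  using (Subset; _∈_; _⊆_; _⊂_; _∪_; _─_; _-_; ⁅_⁆; ∣_∣)
open import Data.Fin.Subset.Properties using (_∈?_)
open import Data.List using (List; map; filter; foldr; allFin)
import Data.List.Membership.Propositional as List
open import Data.List.Extrema.Nat using (max; min)
open import Data.List.Relation.Unary.All using (All; all?)
open import Data.Nat using (ℕ; _∸_; _≟_)
open import Data.Product using (_×_; ∃-syntax)
open import Data.Vec using (zipWith)
open import Function.Bundles using (_⇔_)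
open import Relation.Binary.Construct.Closure.Equivalence using (EqClosure)
open import Relation.Binary.PropositionalEquality using (_≡_)
open import Relation.Nullary using (¬_; yes; no)
open import Relation.Nullary.Decidable using (Dec; ¬?)

private
  variable
    n : ℕ

infixl 6 _△_

_△_ : Subset n → Subset n → Subset n
_△_ = zipWith _xor_

-- The ground set is a subset of an ambient Fin n, so that deletion can remove
-- elements from it without renaming the others.  The finite family of feasible
-- sets is given by a list, in which order and repetitions are irrelevant:
-- every notion below depends only on which sets occur in it.
record SetSystem (n : ℕ) : Set where
  constructor _,,_
  field
    ground   : Subset n
    feasible : List (Subset n)

open SetSystem public

Feasible : SetSystem n → Subset n → Set
Feasible D X = X List.∈ feasible D

record IsDeltaMatroid (D : SetSystem n) : Set where
  field
    feasible⊆ground : ∀ {X} → Feasible D X → X ⊆ ground D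
    nonempty        : ∃[ X ] Feasible D X
    exchange        : ∀ {X Y u} → Feasible D X → Feasible D Y → u ∈ X △ Y →
                      ∃[ v ] (v ∈ X △ Y × Feasible D (X △ (⁅ u ⁆ ∪ ⁅ v ⁆)))

record IsMatroid (D : SetSystem n) : Set where
  field
    isDeltaMatroid  : IsDeltaMatroid D
    equicardinal    : ∀ {X Y} → Feasible D X → Feasible D Y → ∣ X ∣ ≡ ∣ Y ∣

-- The first arguments of max and min are only their values on the empty list;
-- they never affect a non-empty family, since 0 ≤ ∣ X ∣ ≤ n.
maxSize minSize width : SetSystem n → ℕ
maxSize     D = max 0 (map ∣_∣ (feasible D))
minSize {n} D = min n (map ∣_∣ (feasible D))
width       D = maxSize D ∸ minSize D

twist : SetSystem n → Subset n → SetSystem n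
twist D A = ground D ,, map (A △_) (feasible D)

minimal : SetSystem n → SetSystem n
minimal D = ground D ,, filter (λ X → ∣ X ∣ ≟ minSize D) (feasible D)

Coloop : SetSystem n → Fin n → Set
Coloop D e = All (e ∈_) (feasible D)

coloop? : (D : SetSystem n) (e : Fin n) → Dec (Coloop D e)
coloop? D e = all? (e ∈?_) (feasible D)

-- For a coloop e the result is D / e, and e, being in some feasible set,
-- is then not a loop.
delete : SetSystem n → Fin n → SetSystem n
delete D e with coloop? D e
... | no  _ = (ground D - e) ,, filter (λ X → ¬? (e ∈? X)) (feasible D)
... | yes _ = (ground D - e) ,, map (_- e) (filter (e ∈?_) (feasible D))

elements : Subset n → List (Fin n)
elements {n} A = filter (_∈? A) (allFin n)

-- On a delta-matroid the order of the deletions does not matter.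
restrict : SetSystem n → Subset n → SetSystem n
restrict D A = foldr (λ e D′ → delete D′ e) D (elements (ground D ─ A))

-- Matroid notions, for a matroid M presented by its bases.

Independent : SetSystem n → Subset n → Set
Independent M X = ∃[ B ] (Feasible M B × X ⊆ B)

record Circuit (M : SetSystem n) (C : Subset n) : Set where
  field
    ⊆ground   : C ⊆ ground M
    dependent : ¬ Independent M C
    minimally : ∀ {X} → X ⊂ C → Independent M X

ShareCircuit : SetSystem n → Fin n → Fin n → Set
ShareCircuit M e f = ∃[ C ] (Circuit M C × e ∈ C × f ∈ C)

-- The components of M are the classes of this equivalence on the ground set.
-- In a matroid, distinct elements are related exactly when some circuit
-- contains both, so taking the closure only adds reflexivity (for coloops).
SameComponent : SetSystem n → Fin n → Fin n → Set
SameComponent M = EqClosure (ShareCircuit M)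

-- A is the union of the components of the elements of some R ⊆ ground M.
Separator : SetSystem n → Subset n → Set
Separator M A =
  ∃[ R ] (R ⊆ ground M × (∀ x → x ∈ A ⇔ (∃[ e ] (e ∈ R × SameComponent M e x))))

{-# OPTIONS --safe #-}
module Submission where

-- Let c(A) be the least number of elements of A in a feasible set of D.  By the
-- exchange axiom, deleting A lowers the least distance |F △ P| from any
-- P ⊆ E ─ A to a feasible set F by exactly c(A).  Comparing distances from ∅, A and E ─ A gives
--   w(D * A) = w(D | A) + w(D | Ā) + 2λ,   λ = minSize(D | A) - c(A) ≥ 0,
-- so D * A has width one iff λ = 0 and the two widths are 0 and 1.  Bases B of
-- D_min satisfy c(A) ≤ |B ∩ A| ≤ minSize(D | A), with both bounds attained, so
-- λ = 0 iff |B ∩ A| is the same for all bases, which holds iff no circuit of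
-- D_min meets both A and its complement.

open import Data.Bool using (_xor_)
open import Data.Bool.Properties using (xor-assoc; xor-comm; xor-identityʳ)
open import Data.Empty using (⊥-elim)
open import Data.Fin using (Fin; suc; _≟_)
open import Data.Fin.Properties using (any?)
open import Data.Fin.Subset
open import Data.Fin.Subset.Induction using (⊂-wellFounded)
open import Data.Fin.Subset.Properties
open import Data.List using (List; []; _∷_; foldr; map; filter; allFin)
open import Data.List.Extrema.Nat
  using (argmin-sel; argmax-sel; min≤xs; xs≤max; min≈v⁺; max≈v⁺)
import Data.List.Membership.Propositional as List
open import Data.List.Membership.Propositional.Properties
  using (∈-map⁺; ∈-map⁻; ∈-filter⁺; ∈-filter⁻; ∈-allFin)
open import Data.List.Relation.Unary.All as All using (All)
open import Data.List.Relation.Unary.All.Properties using (¬All⇒Any¬; map⁺)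
import Data.List.Relation.Unary.Any as Any
open import Data.Nat as ℕ using (ℕ; suc; _+_; _∸_; _≤_; _<_; z≤n; s≤s)
open import Data.Nat.Properties as ℕ hiding (_≟_)
open import Data.Nat.Tactic.RingSolver using (solve-∀)
open import Data.Product using (_×_; _,_; proj₁; proj₂; ∃-syntax)
open import Data.Sum as Sum using (_⊎_; inj₁; inj₂; [_,_]′)
open import Data.Vec using ([]; _∷_)
open import Data.Vec.Base using (here; there)
open import Data.Vec.Properties using (zipWith-assoc; zipWith-comm; zipWith-identityʳ)
open import Function using (id; _∘_; case_of_)
open import Function.Bundles using (_⇔_; mk⇔; Equivalence)
open import Induction.WellFounded using (Acc; acc)
open import Relation.Binary.Construct.Closure.ReflexiveTransitive using (ε; _◅_; _◅◅_)
open import Relation.Binary.Construct.Closure.Symmetric using (fwd; bwd)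
open import Relation.Binary.PropositionalEquality
open import Relation.Nullary using (¬_; Dec; yes; no; contradiction)
open import Relation.Nullary.Decidable using (¬?; _×-dec_; decidable-stable; map′)
open import Defs

private
  variable
    n : ℕ
    D D′ D″ M : SetSystem n
    A B C X Y p q r : Subset n
    e u v x : Fin n

-- Symmetric differences and sizes of finite subsets.

m+n+o≡m+o+n : ∀ m n o → m + n + o ≡ m + o + n
m+n+o≡m+o+n = solve-∀

△-assoc : (p q r : Subset n) → (p △ q) △ r ≡ p △ (q △ r)
△-assoc = zipWith-assoc xor-assoc

△-comm : (p q : Subset n) → p △ q ≡ q △ p
△-comm = zipWith-comm xor-comm

△-identityʳ : (p : Subset n) → p △ ⊥ ≡ p
△-identityʳ = zipWith-identityʳ xor-identityʳ

x∈p△q⁺ˡ : x ∈ p → x ∉ q → x ∈ p △ q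
x∈p△q⁺ˡ {q = inside  ∷ _} here x∉q = contradiction here x∉q
x∈p△q⁺ˡ {q = outside ∷ _} here x∉q = here
x∈p△q⁺ˡ {q = _ ∷ _} (there x∈p) x∉q = there (x∈p△q⁺ˡ x∈p (x∉q ∘ there))

x∈p△q⁺ʳ : x ∉ p → x ∈ q → x ∈ p △ q
x∈p△q⁺ʳ {p = p} {q} x∉p x∈q = subst (_ ∈_) (△-comm q p) (x∈p△q⁺ˡ x∈q x∉p)

x∈p△q⁻ : ∀ (p q : Subset n) → x ∈ p △ q → (x ∈ p × x ∉ q) ⊎ (x ∉ p × x ∈ q)
x∈p△q⁻ (inside  ∷ _) (outside ∷ _) here = inj₁ (here , λ ())
x∈p△q⁻ (outside ∷ _) (inside  ∷ _) here = inj₂ ((λ ()) , here)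
x∈p△q⁻ (_ ∷ p) (_ ∷ q) (there x∈) with x∈p△q⁻ p q x∈
... | inj₁ (x∈p , x∉q) = inj₁ (there x∈p , x∉q ∘ drop-there)
... | inj₂ (x∉p , x∈q) = inj₂ (x∉p ∘ drop-there , there x∈q)

x∉p△q : x ∉ p → x ∉ q → x ∉ p △ q
x∉p△q {p = p} {q} x∉p x∉q x∈ = [ x∉p ∘ proj₁ , x∉q ∘ proj₂ ]′ (x∈p△q⁻ p q x∈)

x∈p⇒x∉p△q : x ∈ p → x ∈ q → x ∉ p △ q
x∈p⇒x∉p△q {p = p} {q} x∈p x∈q x∈ =
  [ (λ (_ , x∉q) → x∉q x∈q) , (λ (x∉p , _) → x∉p x∈p) ]′ (x∈p△q⁻ p q x∈)

x∈p─q⇒x∉q : ∀ (p q : Subset n) → x ∈ p ─ q → x ∉ q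
x∈p─q⇒x∉q (_ ∷ _) (outside ∷ _) here ()
x∈p─q⇒x∉q (_ ∷ p) (_ ∷ q) (there x∈) (there x∈q) = x∈p─q⇒x∉q p q x∈ x∈q

p△p∩q≡p─q : ∀ (p q : Subset n) → p △ (p ∩ q) ≡ p ─ q
p△p∩q≡p─q [] [] = refl
p△p∩q≡p─q (inside  ∷ p) (inside  ∷ q) = cong (outside ∷_) (p△p∩q≡p─q p q)
p△p∩q≡p─q (inside  ∷ p) (outside ∷ q) = cong (inside  ∷_) (p△p∩q≡p─q p q)
p△p∩q≡p─q (outside ∷ p) (inside  ∷ q) = cong (outside ∷_) (p△p∩q≡p─q p q)
p△p∩q≡p─q (outside ∷ p) (outside ∷ q) = cong (outside ∷_) (p△p∩q≡p─q p q)

p-x△q-x : ∀ (p q : Subset n) x → (p - x) △ (q - x) ≡ (p △ q) - x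
p-x△q-x p q x = ─-△ p q ⁅ x ⁆
  where
  ─-△ : ∀ {n} (p q r : Subset n) → (p ─ r) △ (q ─ r) ≡ (p △ q) ─ r
  ─-△ [] [] [] = refl
  ─-△ (_ ∷ p) (_ ∷ q) (inside  ∷ r) = cong (outside ∷_) (─-△ p q r)
  ─-△ (s ∷ p) (t ∷ q) (outside ∷ r) = cong ((s xor t) ∷_) (─-△ p q r)

x∉p-x : ∀ (p : Subset n) x → x ∉ p - x
x∉p-x p x x∈ = x∈p─q⇒x∉q p ⁅ x ⁆ x∈ (x∈⁅x⁆ x)

x∈p-y⇒x∈p : x ∈ p - u → x ∈ p
x∈p-y⇒x∈p {p = p} {u} = p─q⊆p p ⁅ u ⁆

x∉p⇒p-x≡p : x ∉ p → p - x ≡ p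
x∉p⇒p-x≡p {x = x} {p} x∉p = ⊆-antisym x∈p-y⇒x∈p
  λ y∈p → x∈p∧x≢y⇒x∈p-y y∈p λ { refl → x∉p y∈p }

x∈⁅u⁆∪⁅v⁆⁻ : x ∈ ⁅ u ⁆ ∪ ⁅ v ⁆ → x ≡ u ⊎ x ≡ v
x∈⁅u⁆∪⁅v⁆⁻ {u = u} {v} x∈ with x∈p∪q⁻ ⁅ u ⁆ ⁅ v ⁆ x∈
... | inj₁ x∈u = inj₁ (x∈⁅y⁆⇒x≡y u x∈u)
... | inj₂ x∈v = inj₂ (x∈⁅y⁆⇒x≡y v x∈v)

u∈⁅u⁆∪⁅v⁆ : ∀ (u v : Fin n) → u ∈ ⁅ u ⁆ ∪ ⁅ v ⁆
u∈⁅u⁆∪⁅v⁆ u v = x∈p∪q⁺ (inj₁ (x∈⁅x⁆ u))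

x∉⁅u⁆∪⁅v⁆ : u ∈ p → v ∈ p → x ∉ p → x ∉ ⁅ u ⁆ ∪ ⁅ v ⁆
x∉⁅u⁆∪⁅v⁆ u∈p v∈p x∉p x∈ = [ (λ { refl → x∉p u∈p }) , (λ { refl → x∉p v∈p }) ]′ (x∈⁅u⁆∪⁅v⁆⁻ x∈)

p─[r─q]≡p∩q : ∀ (p q r : Subset n) → p ⊆ r → p ─ (r ─ q) ≡ p ∩ q
p─[r─q]≡p∩q p q r p⊆r = ⊆-antisym
  (λ {x} x∈ → x∈p∩q⁺ (p─q⊆p p (r ─ q) x∈ , decidable-stable (x ∈? q) λ x∉q →
    x∈p─q⇒x∉q p (r ─ q) x∈ (x∈p∧x∉q⇒x∈p─q (p⊆r (p─q⊆p p (r ─ q) x∈)) x∉q)))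
  (λ x∈ → let x∈p , x∈q = x∈p∩q⁻ p q x∈ in
    x∈p∧x∉q⇒x∈p─q x∈p λ x∈r─q → x∈p─q⇒x∉q r q x∈r─q x∈q)

∣p∪q∣≤∣p∣+∣q∣ : ∀ (p q : Subset n) → ∣ p ∪ q ∣ ≤ ∣ p ∣ + ∣ q ∣
∣p∪q∣≤∣p∣+∣q∣ [] [] = z≤n
∣p∪q∣≤∣p∣+∣q∣ (inside  ∷ p) (inside  ∷ q) =
  s≤s (≤-trans (∣p∪q∣≤∣p∣+∣q∣ p q) (+-monoʳ-≤ ∣ p ∣ (n≤1+n _)))
∣p∪q∣≤∣p∣+∣q∣ (inside  ∷ p) (outside ∷ q) = s≤s (∣p∪q∣≤∣p∣+∣q∣ p q)
∣p∪q∣≤∣p∣+∣q∣ (outside ∷ p) (inside  ∷ q) =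
  ≤-trans (s≤s (∣p∪q∣≤∣p∣+∣q∣ p q)) (≤-reflexive (sym (+-suc ∣ p ∣ ∣ q ∣)))
∣p∪q∣≤∣p∣+∣q∣ (outside ∷ p) (outside ∷ q) = ∣p∪q∣≤∣p∣+∣q∣ p q

∣p∩q∣+∣p─q∣≡∣p∣ : ∀ (p q : Subset n) → ∣ p ∩ q ∣ + ∣ p ─ q ∣ ≡ ∣ p ∣
∣p∩q∣+∣p─q∣≡∣p∣ [] [] = refl
∣p∩q∣+∣p─q∣≡∣p∣ (inside  ∷ p) (inside  ∷ q) = cong suc (∣p∩q∣+∣p─q∣≡∣p∣ p q)
∣p∩q∣+∣p─q∣≡∣p∣ (inside  ∷ p) (outside ∷ q) =
  trans (+-suc ∣ p ∩ q ∣ _) (cong suc (∣p∩q∣+∣p─q∣≡∣p∣ p q))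
∣p∩q∣+∣p─q∣≡∣p∣ (outside ∷ p) (inside  ∷ q) = ∣p∩q∣+∣p─q∣≡∣p∣ p q
∣p∩q∣+∣p─q∣≡∣p∣ (outside ∷ p) (outside ∷ q) = ∣p∩q∣+∣p─q∣≡∣p∣ p q

∣p∩q∪r─q∣≡∣p∩q∣+∣r─q∣ : ∀ (p q r : Subset n) →
                       ∣ (p ∩ q) ∪ (r ─ q) ∣ ≡ ∣ p ∩ q ∣ + ∣ r ─ q ∣
∣p∩q∪r─q∣≡∣p∩q∣+∣r─q∣ [] [] [] = refl
∣p∩q∪r─q∣≡∣p∩q∣+∣r─q∣ (inside  ∷ p) (inside  ∷ q) (_ ∷ r) = cong suc (∣p∩q∪r─q∣≡∣p∩q∣+∣r─q∣ p q r)
∣p∩q∪r─q∣≡∣p∩q∣+∣r─q∣ (outside ∷ p) (inside  ∷ q) (_ ∷ r) = ∣p∩q∪r─q∣≡∣p∩q∣+∣r─q∣ p q r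
∣p∩q∪r─q∣≡∣p∩q∣+∣r─q∣ (inside  ∷ p) (outside ∷ q) (inside  ∷ r) =
  trans (cong suc (∣p∩q∪r─q∣≡∣p∩q∣+∣r─q∣ p q r)) (sym (+-suc ∣ p ∩ q ∣ _))
∣p∩q∪r─q∣≡∣p∩q∣+∣r─q∣ (outside ∷ p) (outside ∷ q) (inside  ∷ r) =
  trans (cong suc (∣p∩q∪r─q∣≡∣p∩q∣+∣r─q∣ p q r)) (sym (+-suc ∣ p ∩ q ∣ _))
∣p∩q∪r─q∣≡∣p∩q∣+∣r─q∣ (inside  ∷ p) (outside ∷ q) (outside ∷ r) = ∣p∩q∪r─q∣≡∣p∩q∣+∣r─q∣ p q r
∣p∩q∪r─q∣≡∣p∩q∣+∣r─q∣ (outside ∷ p) (outside ∷ q) (outside ∷ r) = ∣p∩q∪r─q∣≡∣p∩q∣+∣r─q∣ p q r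

∣p△q∣+∣p∣≡∣q∣ : ∀ (p q : Subset n) → p ⊆ q → ∣ p △ q ∣ + ∣ p ∣ ≡ ∣ q ∣
∣p△q∣+∣p∣≡∣q∣ [] [] _ = refl
∣p△q∣+∣p∣≡∣q∣ (inside  ∷ p) (inside  ∷ q) p⊆q =
  trans (+-suc ∣ p △ q ∣ _) (cong suc (∣p△q∣+∣p∣≡∣q∣ p q (drop-∷-⊆ p⊆q)))
∣p△q∣+∣p∣≡∣q∣ (inside  ∷ p) (outside ∷ q) p⊆q with () ← p⊆q here
∣p△q∣+∣p∣≡∣q∣ (outside ∷ p) (inside  ∷ q) p⊆q = cong suc (∣p△q∣+∣p∣≡∣q∣ p q (drop-∷-⊆ p⊆q))
∣p△q∣+∣p∣≡∣q∣ (outside ∷ p) (outside ∷ q) p⊆q = ∣p△q∣+∣p∣≡∣q∣ p q (drop-∷-⊆ p⊆q)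

p⊆q⇒∣p∣+∣q─p∣≡∣q∣ : ∀ (p q : Subset n) → p ⊆ q → ∣ p ∣ + ∣ q ─ p ∣ ≡ ∣ q ∣
p⊆q⇒∣p∣+∣q─p∣≡∣q∣ p q p⊆q = trans (cong (λ r → ∣ r ∣ + ∣ q ─ p ∣) p≡q∩p) (∣p∩q∣+∣p─q∣≡∣p∣ q p)
  where
  p≡q∩p : p ≡ q ∩ p
  p≡q∩p = ⊆-antisym (λ x∈p → x∈p∩q⁺ (p⊆q x∈p , x∈p)) (p∩q⊆q q p)

∣p△q∣≡∣q△p∣ : ∀ (p q : Subset n) → ∣ p △ q ∣ ≡ ∣ q △ p ∣
∣p△q∣≡∣q△p∣ p q = cong ∣_∣ (△-comm p q)

∣p△p∣≡0 : ∀ (p : Subset n) → ∣ p △ p ∣ ≡ 0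
∣p△p∣≡0 p = +-cancelʳ-≡ ∣ p ∣ _ _ (∣p△q∣+∣p∣≡∣q∣ p p id)

-- Within r, the sets p △ q and (r ─ p) △ q are complementary.
∣p△q∣+∣r─p△q∣≡∣r∣ : ∀ (p q r : Subset n) → p ⊆ r → q ⊆ r →
                   ∣ p △ q ∣ + ∣ (r ─ p) △ q ∣ ≡ ∣ r ∣
∣p△q∣+∣r─p△q∣≡∣r∣ p q r p⊆r q⊆r =
  trans (cong (λ s → ∣ p △ q ∣ + ∣ s ∣) eq) (p⊆q⇒∣p∣+∣q─p∣≡∣q∣ (p △ q) r △⊆)
  where
  △⊆ : p △ q ⊆ r
  △⊆ x∈ = [ p⊆r ∘ proj₁ , q⊆r ∘ proj₂ ]′ (x∈p△q⁻ p q x∈)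
  to : (r ─ p) △ q ⊆ r ─ (p △ q)
  to x∈ with x∈p△q⁻ (r ─ p) q x∈
  ... | inj₁ (x∈ , x∉q) =
    x∈p∧x∉q⇒x∈p─q (p─q⊆p r p x∈) (x∉p△q (x∈p─q⇒x∉q r p x∈) x∉q)
  ... | inj₂ (x∉ , x∈q) = x∈p∧x∉q⇒x∈p─q (q⊆r x∈q) λ x∈△ →
    [ (λ (_ , x∉q) → x∉q x∈q) , (λ (x∉p , _) → x∉ (x∈p∧x∉q⇒x∈p─q (q⊆r x∈q) x∉p)) ]′ (x∈p△q⁻ p q x∈△)
  from : r ─ (p △ q) ⊆ (r ─ p) △ q
  from {x} x∈ with x ∈? q | x ∈? p
  ... | yes x∈q | yes x∈p = x∈p△q⁺ʳ (λ x∈′ → x∈p─q⇒x∉q r p x∈′ x∈p) x∈q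
  ... | yes x∈q | no  x∉p = contradiction (x∈p△q⁺ʳ x∉p x∈q) (x∈p─q⇒x∉q r (p △ q) x∈)
  ... | no  x∉q | yes x∈p = contradiction (x∈p△q⁺ˡ x∈p x∉q) (x∈p─q⇒x∉q r (p △ q) x∈)
  ... | no  x∉q | no  x∉p = x∈p△q⁺ˡ (x∈p∧x∉q⇒x∈p─q (p─q⊆p r _ x∈) x∉p) x∉q
  eq : (r ─ p) △ q ≡ r ─ (p △ q)
  eq = ⊆-antisym to from

∣p△q∣≡∣p-x△q∣+1 : ∀ (q : Subset n) → x ∈ p → x ∉ q → ∣ p △ q ∣ ≡ ∣ (p - x) △ q ∣ + 1
∣p△q∣≡∣p-x△q∣+1 (inside  ∷ _) here x∉q = contradiction here x∉q
∣p△q∣≡∣p-x△q∣+1 {p = _ ∷ p} (outside ∷ q) here _ =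
  trans (cong (λ s → suc ∣ s △ q ∣) (sym (p─⊥≡p p))) (+-comm 1 _)
∣p△q∣≡∣p-x△q∣+1 {p = inside  ∷ _} (inside  ∷ q) (there x∈p) x∉q = ∣p△q∣≡∣p-x△q∣+1 q x∈p (x∉q ∘ there)
∣p△q∣≡∣p-x△q∣+1 {p = inside  ∷ _} (outside ∷ q) (there x∈p) x∉q = cong suc (∣p△q∣≡∣p-x△q∣+1 q x∈p (x∉q ∘ there))
∣p△q∣≡∣p-x△q∣+1 {p = outside ∷ _} (inside  ∷ q) (there x∈p) x∉q = cong suc (∣p△q∣≡∣p-x△q∣+1 q x∈p (x∉q ∘ there))
∣p△q∣≡∣p-x△q∣+1 {p = outside ∷ _} (outside ∷ q) (there x∈p) x∉q = ∣p△q∣≡∣p-x△q∣+1 q x∈p (x∉q ∘ there)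

-- Toggling `u` removes it from `p`, and toggling `v` adds at most one element in its place; `v = u`
-- is allowed.
∣p△uv∣≤∣p∣ : ∀ {p : Subset n} {u} v → u ∈ p → ∣ p △ (⁅ u ⁆ ∪ ⁅ v ⁆) ∣ ≤ ∣ p ∣
∣p△uv∣≤∣p∣ {p = p} {u} v u∈p = begin
  ∣ p △ (⁅ u ⁆ ∪ ⁅ v ⁆) ∣  ≤⟨ p⊆q⇒∣p∣≤∣q∣ sub ⟩
  ∣ (p - u) ∪ ⁅ v ⁆ ∣      ≤⟨ ∣p∪q∣≤∣p∣+∣q∣ (p - u) ⁅ v ⁆ ⟩
  ∣ p - u ∣ + ∣ ⁅ v ⁆ ∣    ≡⟨ cong (∣ p - u ∣ +_) (∣⁅x⁆∣≡1 v) ⟩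
  ∣ p - u ∣ + 1            ≡⟨ +-comm _ 1 ⟩
  suc ∣ p - u ∣            ≤⟨ x∈p⇒∣p-x∣<∣p∣ u∈p ⟩
  ∣ p ∣                    ∎
  where
  open ≤-Reasoning
  sub : p △ (⁅ u ⁆ ∪ ⁅ v ⁆) ⊆ (p - u) ∪ ⁅ v ⁆
  sub x∈ with x∈p△q⁻ p (⁅ u ⁆ ∪ ⁅ v ⁆) x∈
  ... | inj₁ (x∈p , x∉) = x∈p∪q⁺ (inj₁ (x∈p∧x≢y⇒x∈p-y x∈p λ { refl → x∉ (u∈⁅u⁆∪⁅v⁆ u v) }))
  ... | inj₂ (x∉p , x∈uv) with x∈⁅u⁆∪⁅v⁆⁻ x∈uv
  ...   | inj₁ refl = contradiction u∈p x∉p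
  ...   | inj₂ refl = x∈p∪q⁺ (inj₂ (x∈⁅x⁆ v))

p─q⊆p△r : ∀ (p q r : Subset n) → r ⊆ q → p ─ q ⊆ p △ r
p─q⊆p△r p q r r⊆q x∈ = x∈p△q⁺ˡ (p─q⊆p p q x∈) (x∈p─q⇒x∉q p q x∈ ∘ r⊆q)

-- Extreme sizes and the width of a set system.

Nonvoid : SetSystem n → Set
Nonvoid D = ∃[ X ] Feasible D X

minSize≤ : Feasible D X → minSize D ≤ ∣ X ∣
minSize≤ X∈ = All.lookup (min≤xs _ _) (∈-map⁺ ∣_∣ X∈)

≤maxSize : Feasible D X → ∣ X ∣ ≤ maxSize D
≤maxSize X∈ = All.lookup (xs≤max _ _) (∈-map⁺ ∣_∣ X∈)

minSize≡ : Feasible D X → (∀ {Y} → Feasible D Y → ∣ X ∣ ≤ ∣ Y ∣) → minSize D ≡ ∣ X ∣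
minSize≡ {X = X} X∈ X≤ =
  min≈v⁺ (∈-map⁺ ∣_∣ X∈) (map⁺ (All.tabulate X≤)) (∣p∣≤n X)

maxSize≡ : Feasible D X → (∀ {Y} → Feasible D Y → ∣ Y ∣ ≤ ∣ X ∣) → maxSize D ≡ ∣ X ∣
maxSize≡ X∈ ≤X = max≈v⁺ (∈-map⁺ ∣_∣ X∈) (map⁺ (All.tabulate ≤X)) z≤n

minSize-attained : Nonvoid D → ∃[ X ] (Feasible D X × minSize D ≡ ∣ X ∣)
minSize-attained {n} {D} (X , X∈) with argmin-sel id n (map ∣_∣ (feasible D))
-- If the minimum is the default `n`, then `∣ X ∣ ≤ n` forces any feasible `X` to attain it.
... | inj₁ min≡n = X , X∈ , ≤-antisym (minSize≤ {D = D} X∈) (≤-trans (∣p∣≤n X) (≤-reflexive (sym min≡n)))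
... | inj₂ min∈  = ∈-map⁻ ∣_∣ min∈

maxSize-attained : Nonvoid D → ∃[ X ] (Feasible D X × maxSize D ≡ ∣ X ∣)
maxSize-attained {D = D} (X , X∈) with argmax-sel id 0 (map ∣_∣ (feasible D))
... | inj₁ max≡0 = X , X∈ , ≤-antisym (≤-trans (≤-reflexive max≡0) z≤n) (≤maxSize {D = D} X∈)
... | inj₂ max∈  = ∈-map⁻ ∣_∣ max∈

-- On a non-void family the truncated subtraction in `width` is exact; the later arithmetic uses
-- this additive form.
width+minSize≡maxSize : Nonvoid D → width D + minSize D ≡ maxSize D
width+minSize≡maxSize {D = D} (_ , X∈) = m∸n+n≡m (≤-trans (minSize≤ {D = D} X∈) (≤maxSize {D = D} X∈))

isMatroid⇒width≡0 : IsMatroid D → width D ≡ 0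
isMatroid⇒width≡0 {D = D} M
  with X , X∈ , max≡ ← maxSize-attained {D = D} (IsDeltaMatroid.nonempty (IsMatroid.isDeltaMatroid M))
     | Y , Y∈ , min≡ ← minSize-attained {D = D} (IsDeltaMatroid.nonempty (IsMatroid.isDeltaMatroid M))
  = m≤n⇒m∸n≡0 (≤-reflexive (trans max≡ (trans (IsMatroid.equicardinal M X∈ Y∈) (sym min≡))))

width≡0⇒isMatroid : IsDeltaMatroid D → width D ≡ 0 → IsMatroid D
width≡0⇒isMatroid {D = D} dm w≡0 = record
  { isDeltaMatroid = dm
  ; equicardinal   = λ X∈ Y∈ → ≤-antisym (bound X∈ Y∈) (bound Y∈ X∈)
  }
  where
  bound : Feasible D X → Feasible D Y → ∣ X ∣ ≤ ∣ Y ∣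
  bound X∈ Y∈ = ≤-trans (≤maxSize {D = D} X∈)
    (≤-trans (m∸n≡0⇒m≤n w≡0) (minSize≤ {D = D} Y∈))

-- Deletion measured by distances from feasible sets.

-- D′ arises from D by deletions, cost of which hit a coloop.  Both extreme sizes
-- in D′ (P = ⊥ and P = ground D′) and the least number of elements that a feasible
-- set of D has outside ground D′ are distances ∣ X △ P ∣, so comparing these suffices.
record Projection (D D′ : SetSystem n) : Set where
  field
    cost    : ℕ
    ground⊆ : ground D′ ⊆ ground D
    lift    : Feasible D′ X → ∃[ Y ] (Feasible D Y ×
                (∀ P → P ⊆ ground D′ → ∣ Y △ P ∣ ≡ ∣ X △ P ∣ + cost))
    project : ∀ P → P ⊆ ground D′ → Feasible D Y →
                ∃[ X ] (Feasible D′ X × ∣ X △ P ∣ + cost ≤ ∣ Y △ P ∣)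

Projection-refl : Projection D D
Projection-refl = record
  { cost    = 0
  ; ground⊆ = id
  ; lift    = λ X∈ → _ , X∈ , λ _ _ → sym (+-identityʳ _)
  ; project = λ _ _ X∈ → _ , X∈ , ≤-reflexive (+-identityʳ _)
  }

Projection-trans : Projection D D′ → Projection D′ D″ → Projection D D″
Projection-trans π ρ = record
  { cost    = ρ.cost + π.cost
  ; ground⊆ = π.ground⊆ ∘ ρ.ground⊆
  ; lift    = λ X∈ →
      let Y , Y∈ , eq = ρ.lift X∈ ; Z , Z∈ , eq′ = π.lift Y∈ in
      Z , Z∈ , λ P P⊆ → trans (eq′ P (ρ.ground⊆ ∘ P⊆))
        (trans (cong (_+ π.cost) (eq P P⊆)) (+-assoc _ ρ.cost π.cost))
  ; project = λ P P⊆ Z∈ →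
      let Y , Y∈ , le = π.project P (ρ.ground⊆ ∘ P⊆) Z∈ ; X , X∈ , le′ = ρ.project P P⊆ Y∈ in
      X , X∈ , ≤-trans (≤-reflexive (sym (+-assoc _ ρ.cost π.cost)))
        (≤-trans (+-monoˡ-≤ π.cost le′) le)
  }
  where
  module π = Projection π
  module ρ = Projection ρ

-- Deletion of a single element.

avoiding : ¬ Coloop D e → ∃[ X ] (Feasible D X × e ∉ X)
avoiding {D = D} {e} ¬coloop = List.find (¬All⇒Any¬ (e ∈?_) (feasible D) ¬coloop)

ground-delete : (D : SetSystem n) (e : Fin n) → ground (delete D e) ≡ ground D - e
ground-delete D e with coloop? D e
... | no  _ = refl
... | yes _ = refl

-- Two feasible sets that both avoid `e`, or both contain it, do not differ in `e`. An exchange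
-- between them therefore never touches `e`: it preserves avoidance of `e`, and it commutes with the
-- removal of a coloop `e`.
delete-isDeltaMatroid : IsDeltaMatroid D → ∀ e → IsDeltaMatroid (delete D e)
delete-isDeltaMatroid {n} {D} dm e with coloop? D e
... | no ¬coloop = record
  { feasible⊆ground = λ X∈ x∈X →
      let X∈D , e∉X = ∈-filter⁻ avoids X∈ in
      x∈p∧x≢y⇒x∈p-y (feasible⊆ground X∈D x∈X) λ { refl → e∉X x∈X }
  ; nonempty        = let X , X∈ , e∉X = avoiding {D = D} ¬coloop in X , ∈-filter⁺ avoids X∈ e∉X
  ; exchange        = λ X∈ Y∈ u∈ →
      let X∈D , e∉X = ∈-filter⁻ avoids X∈
          Y∈D , e∉Y = ∈-filter⁻ avoids Y∈
          v , v∈ , Z∈ = exchange X∈D Y∈D u∈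
      in v , v∈ , ∈-filter⁺ avoids Z∈ (x∉p△q e∉X (x∉⁅u⁆∪⁅v⁆ u∈ v∈ (x∉p△q e∉X e∉Y)))
  }
  where
  open IsDeltaMatroid dm
  avoids = λ X → ¬? (e ∈? X)
... | yes coloop = record
  { feasible⊆ground = ⊆ground
  ; nonempty        = let X , X∈ = nonempty in X - e , contracted X∈
  ; exchange        = exch
  }
  where
  open IsDeltaMatroid dm
  contracted : Feasible D X → (X - e) List.∈ map (_- e) (filter (e ∈?_) (feasible D))
  contracted X∈ = ∈-map⁺ (_- e) (∈-filter⁺ (e ∈?_) X∈ (All.lookup coloop X∈))
  expanded : X List.∈ map (_- e) (filter (e ∈?_) (feasible D)) →
             ∃[ Y ] (Feasible D Y × X ≡ Y - e)
  expanded X∈ = let Y , Y∈ , eq = ∈-map⁻ (_- e) X∈ in Y , proj₁ (∈-filter⁻ (e ∈?_) Y∈) , eq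
  ⊆ground : X List.∈ map (_- e) (filter (e ∈?_) (feasible D)) → X ⊆ ground D - e
  ⊆ground X∈ x∈X with Y , Y∈ , refl ← expanded X∈ =
    x∈p∧x≢y⇒x∈p-y (feasible⊆ground Y∈ (x∈p-y⇒x∈p x∈X)) λ { refl → x∉p-x Y e x∈X }
  exch : X List.∈ map (_- e) (filter (e ∈?_) (feasible D)) →
         Y List.∈ map (_- e) (filter (e ∈?_) (feasible D)) → u ∈ X △ Y →
         ∃[ v ] (v ∈ X △ Y × (X △ (⁅ u ⁆ ∪ ⁅ v ⁆)) List.∈ map (_- e) (filter (e ∈?_) (feasible D)))
  exch {u = u} X∈ Y∈ u∈
    with X , X∈D , refl ← expanded X∈ | Y , Y∈D , refl ← expanded Y∈
    rewrite p-x△q-x X Y e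
    with v , v∈ , Z∈ ← exchange X∈D Y∈D (x∈p-y⇒x∈p u∈)
    = v , subst (v ∈_) (sym X△Y-e) v∈ , subst (List._∈ _) eq (contracted Z∈)
    where
    e∉X△Y : e ∉ X △ Y
    e∉X△Y = x∈p⇒x∉p△q (All.lookup coloop X∈D) (All.lookup coloop Y∈D)
    X△Y-e : (X △ Y) - e ≡ X △ Y
    X△Y-e = x∉p⇒p-x≡p e∉X△Y
    eq : (X △ (⁅ u ⁆ ∪ ⁅ v ⁆)) - e ≡ (X - e) △ (⁅ u ⁆ ∪ ⁅ v ⁆)
    eq = trans (sym (p-x△q-x X (⁅ u ⁆ ∪ ⁅ v ⁆) e))
      (cong ((X - e) △_) (x∉p⇒p-x≡p (x∉⁅u⁆∪⁅v⁆ (x∈p-y⇒x∈p u∈) v∈ e∉X△Y)))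

-- The sets `P` avoid `e`, so contracting a coloop `e` lowers every distance to `P` by exactly one.
-- If `e` is not a coloop, a feasible set containing it can be replaced by one that avoids it and is
-- no farther from `P`, at cost 0.
delete-projection : IsDeltaMatroid D → ∀ e → Projection D (delete D e)
delete-projection {n} {D} dm e with coloop? D e
... | yes coloop = record
  { cost    = 1
  ; ground⊆ = x∈p-y⇒x∈p
  ; lift    = lift
  ; project = λ {Y} P P⊆ Y∈ → let e∈Y = All.lookup coloop Y∈ in
      Y - e , ∈-map⁺ (_- e) (∈-filter⁺ (e ∈?_) Y∈ e∈Y) ,
      ≤-reflexive (sym (∣p△q∣≡∣p-x△q∣+1 P e∈Y (x∉p-x (ground D) e ∘ P⊆)))
  }
  where
  lift : X List.∈ map (_- e) (filter (e ∈?_) (feasible D)) →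
         ∃[ Y ] (Feasible D Y × (∀ P → P ⊆ ground D - e → ∣ Y △ P ∣ ≡ ∣ X △ P ∣ + 1))
  lift X∈ with Y , Y∈ , refl ← ∈-map⁻ (_- e) X∈ =
    Y , proj₁ (∈-filter⁻ (e ∈?_) Y∈) , λ P P⊆ →
    ∣p△q∣≡∣p-x△q∣+1 P (proj₂ (∈-filter⁻ (e ∈?_) {xs = feasible D} Y∈)) (x∉p-x (ground D) e ∘ P⊆)
... | no ¬coloop = record
  { cost    = 0
  ; ground⊆ = x∈p-y⇒x∈p
  ; lift    = λ X∈ → _ , proj₁ (∈-filter⁻ avoids X∈) , λ _ _ → sym (+-identityʳ _)
  ; project = λ {Y} P P⊆ Y∈ → let X , X∈ , e∉X , le = project P P⊆ Y∈ in
      X , ∈-filter⁺ avoids X∈ e∉X , ≤-trans (≤-reflexive (+-identityʳ _)) le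
  }
  where
  open IsDeltaMatroid dm
  avoids = λ X → ¬? (e ∈? X)
  project : ∀ P → P ⊆ ground D - e → Feasible D Y →
            ∃[ X ] (Feasible D X × e ∉ X × ∣ X △ P ∣ ≤ ∣ Y △ P ∣)
  project {Y} P P⊆ Y∈ with e ∈? Y
  ... | no  e∉Y = Y , Y∈ , e∉Y , ≤-refl
  ... | yes e∈Y =
    -- Exchanging e against an avoiding set Z changes Y △ P in e ∈ Y △ P and
    -- in at most one other element.
    let Z , Z∈ , e∉Z = avoiding {D = D} ¬coloop
        v , v∈ , X∈ = exchange Y∈ Z∈ (x∈p△q⁺ˡ e∈Y e∉Z)
        ev = ⁅ e ⁆ ∪ ⁅ v ⁆
    in Y △ ev , X∈ , x∈p⇒x∉p△q e∈Y (u∈⁅u⁆∪⁅v⁆ e v) , ≤-trans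
         (≤-reflexive (cong ∣_∣ (trans (△-assoc Y ev P)
           (trans (cong (Y △_) (△-comm ev P)) (sym (△-assoc Y P ev))))))
         (∣p△uv∣≤∣p∣ v (x∈p△q⁺ˡ e∈Y (x∉p-x (ground D) e ∘ P⊆)))

-- Repeated deletion and restriction.

deleteAll : SetSystem n → List (Fin n) → SetSystem n
deleteAll = foldr (λ e D → delete D e)

deleteAll-isDeltaMatroid : IsDeltaMatroid D → ∀ es → IsDeltaMatroid (deleteAll D es)
deleteAll-isDeltaMatroid dm []       = dm
deleteAll-isDeltaMatroid dm (e ∷ es) = delete-isDeltaMatroid (deleteAll-isDeltaMatroid dm es) e

deleteAll-projection : IsDeltaMatroid D → ∀ es → Projection D (deleteAll D es)
deleteAll-projection dm []       = Projection-refl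
deleteAll-projection dm (e ∷ es) = Projection-trans (deleteAll-projection dm es)
  (delete-projection (deleteAll-isDeltaMatroid dm es) e)

∈-ground-deleteAll⁺ : ∀ es → x ∈ ground D → ¬ x List.∈ es → x ∈ ground (deleteAll D es)
∈-ground-deleteAll⁺ [] x∈ _ = x∈
∈-ground-deleteAll⁺ {D = D} (e ∷ es) x∈ x∉ rewrite ground-delete (deleteAll D es) e =
  x∈p∧x≢y⇒x∈p-y (∈-ground-deleteAll⁺ {D = D} es x∈ (x∉ ∘ Any.there)) (x∉ ∘ Any.here)

∈-ground-deleteAll⁻ : ∀ es → x ∈ ground (deleteAll D es) → x ∈ ground D × ¬ x List.∈ es
∈-ground-deleteAll⁻ [] x∈ = x∈ , λ ()
∈-ground-deleteAll⁻ {D = D} (e ∷ es) x∈ rewrite ground-delete (deleteAll D es) e =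
  let x∈D , x∉es = ∈-ground-deleteAll⁻ {D = D} es (x∈p-y⇒x∈p x∈) in
  x∈D , λ { (Any.here refl)  → x∉p-x _ e x∈ ; (Any.there x∈es) → x∉es x∈es }

ground-restrict : ∀ (D : SetSystem n) {A} → A ⊆ ground D → ground (restrict D A) ≡ A
ground-restrict D {A} A⊆ = ⊆-antisym to from
  where
  E─A = ground D ─ A
  to : ground (restrict D A) ⊆ A
  to {x} x∈ with x∈D , x∉ ← ∈-ground-deleteAll⁻ {D = D} (elements E─A) x∈ | x ∈? A
  ... | yes x∈A = x∈A
  ... | no  x∉A = contradiction
    (∈-filter⁺ (_∈? E─A) (∈-allFin x) (x∈p∧x∉q⇒x∈p─q x∈D x∉A)) x∉
  from : A ⊆ ground (restrict D A)
  from x∈A = ∈-ground-deleteAll⁺ {D = D} (elements E─A) (A⊆ x∈A)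
    λ x∈es → x∈p─q⇒x∉q (ground D) A (proj₂ (∈-filter⁻ (_∈? E─A) {xs = allFin _} x∈es)) x∈A

-- Extreme sizes and twists read off from distances.

module _ (dm : IsDeltaMatroid D) (dm′ : IsDeltaMatroid D′) (π : Projection D D′) where
  open Projection π
  private module D′ = IsDeltaMatroid dm′

  -- Here `lift` is evaluated twice: `P = ⊥` turns distances into sizes, and `P = X` gives the
  -- distance of the lifted set from `X` itself.
  lift-size : Feasible D′ X → ∃[ Y ] (Feasible D Y × ∣ Y ∣ ≡ ∣ X ∣ + cost × ∣ Y △ X ∣ ≡ cost)
  lift-size {X = X} X∈ =
    let Y , Y∈ , eq = lift X∈ in
    Y , Y∈
    , subst₂ (λ p q → ∣ p ∣ ≡ ∣ q ∣ + cost) (△-identityʳ Y) (△-identityʳ X) (eq ⊥ ⊥⊆)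
    , trans (eq X (D′.feasible⊆ground X∈)) (cong (_+ cost) (∣p△p∣≡0 X))

  -- Distances from `⊥` are sizes. Projecting any feasible `Z` loses at least `cost`, so the lift of
  -- a smallest set of `D′` is smallest in `D`.
  minSize-projection : minSize D ≡ minSize D′ + cost
  minSize-projection =
    let X , X∈ , minX = minSize-attained {D = D′} D′.nonempty
        Y , Y∈ , ∣Y∣ , _ = lift-size X∈
    in trans (minSize≡ {D = D} Y∈ λ {Z} Z∈ →
         let X′ , X′∈ , le = project ⊥ ⊥⊆ Z∈ in
         begin
           ∣ Y ∣              ≡⟨ ∣Y∣ ⟩
           ∣ X ∣ + cost       ≤⟨ +-monoˡ-≤ cost (≤-trans (≤-reflexive (sym minX)) (minSize≤ {D = D′} X′∈)) ⟩
           ∣ X′ ∣ + cost      ≡⟨ cong (λ p → ∣ p ∣ + cost) (△-identityʳ X′) ⟨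
           ∣ X′ △ ⊥ ∣ + cost  ≤⟨ le ⟩
           ∣ Z △ ⊥ ∣          ≡⟨ cong ∣_∣ (△-identityʳ Z) ⟩
           ∣ Z ∣              ∎)
       (trans ∣Y∣ (cong (_+ cost) (sym minX)))
    where open ≤-Reasoning

  -- Sizes in the twist are distances from `A`. For a subset of `A` this distance and the size add
  -- up to `∣ A ∣`, so the feasible set of `D′` nearest to `A` is a largest one, and lifting it adds
  -- `cost`.
  minSize-twist : ground D′ ≡ A → minSize (twist D A) + maxSize D′ ≡ ∣ A ∣ + cost
  minSize-twist {A = A} refl =
    let X , X∈ , maxX = maxSize-attained {D = D′} D′.nonempty
        Y , Y∈ , eq = lift X∈
        Y-min : ∀ {W} → Feasible (twist D A) W → ∣ A △ Y ∣ ≤ ∣ W ∣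
        Y-min W∈ = case ∈-map⁻ (A △_) W∈ of λ { (Z , Z∈ , refl) →
          let X′ , X′∈ , le = project A id Z∈
              X≤X′ : ∣ X △ A ∣ ≤ ∣ X′ △ A ∣
              X≤X′ = +-cancelʳ-≤ ∣ X ∣ _ _ (begin
                ∣ X △ A ∣ + ∣ X ∣    ≡⟨ ∣p△q∣+∣p∣≡∣q∣ X A (D′.feasible⊆ground X∈) ⟩
                ∣ A ∣                ≡⟨ ∣p△q∣+∣p∣≡∣q∣ X′ A (D′.feasible⊆ground X′∈) ⟨
                ∣ X′ △ A ∣ + ∣ X′ ∣  ≤⟨ +-monoʳ-≤ _ (≤-trans (≤maxSize {D = D′} X′∈) (≤-reflexive maxX)) ⟩
                ∣ X′ △ A ∣ + ∣ X ∣   ∎)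
          in begin
            ∣ A △ Y ∣          ≡⟨ ∣p△q∣≡∣q△p∣ A Y ⟩
            ∣ Y △ A ∣          ≡⟨ eq A id ⟩
            ∣ X △ A ∣ + cost   ≤⟨ +-monoˡ-≤ cost X≤X′ ⟩
            ∣ X′ △ A ∣ + cost  ≤⟨ le ⟩
            ∣ Z △ A ∣          ≡⟨ ∣p△q∣≡∣q△p∣ Z A ⟩
            ∣ A △ Z ∣          ∎ }
    in begin-equality
      minSize (twist D A) + maxSize D′  ≡⟨ cong₂ _+_ (minSize≡ {D = twist D A} (∈-map⁺ (A △_) Y∈) Y-min) maxX ⟩
      ∣ A △ Y ∣ + ∣ X ∣                 ≡⟨ cong (_+ ∣ X ∣) (trans (∣p△q∣≡∣q△p∣ A Y) (eq A id)) ⟩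
      ∣ X △ A ∣ + cost + ∣ X ∣          ≡⟨ m+n+o≡m+o+n (∣ X △ A ∣) cost (∣ X ∣) ⟩
      ∣ X △ A ∣ + ∣ X ∣ + cost          ≡⟨ cong (_+ cost) (∣p△q∣+∣p∣≡∣q∣ X A (D′.feasible⊆ground X∈)) ⟩
      ∣ A ∣ + cost                      ∎
    where
    open ≤-Reasoning

  -- Every distance from a feasible set of `D` to a subset of `ground D′` is at least `cost`; the
  -- trace `Y ∩ ground D′` is at distance `∣ Y ─ ground D′ ∣` from `Y`.
  cost≤∣Y─ground∣ : Feasible D Y → cost ≤ ∣ Y ─ ground D′ ∣
  cost≤∣Y─ground∣ {Y = Y} Y∈ =
    let X , _ , le = project (Y ∩ ground D′) (p∩q⊆q Y (ground D′)) Y∈ in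
    ≤-trans (m≤n+m cost _) (≤-trans le (≤-reflexive (cong ∣_∣ (p△p∩q≡p─q Y (ground D′)))))

  -- The bound in `cost≤∣Y─ground∣` is attained by a feasible set that also has minimum size. It is
  -- the lift of a smallest `X` of `D′`: as `X` stays inside `ground D′`, all of `Y ─ ground D′`
  -- lies in `Y △ X`, which has only `cost` elements.
  lift-minSize : ∃[ Y ] (Feasible D Y × ∣ Y ∣ ≡ minSize D × ∣ Y ─ ground D′ ∣ ≡ cost)
  lift-minSize =
    let X , X∈ , minX = minSize-attained {D = D′} D′.nonempty
        Y , Y∈ , ∣Y∣ , ∣Y△X∣ = lift-size X∈
    in Y , Y∈
       , trans ∣Y∣ (trans (cong (_+ cost) (sym minX)) (sym minSize-projection))
       , ≤-antisym (≤-trans (p⊆q⇒∣p∣≤∣q∣ (p─q⊆p△r Y (ground D′) X (D′.feasible⊆ground X∈))) (≤-reflexive ∣Y△X∣))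
                   (cost≤∣Y─ground∣ Y∈)

-- Twisting one feasible set by `A` and by its complement gives complementary subsets of the ground
-- set, so a largest set of one twist corresponds to a smallest set of the other.
maxSize-twist : IsDeltaMatroid D → A ⊆ ground D →
                maxSize (twist D A) + minSize (twist D (ground D ─ A)) ≡ ∣ ground D ∣
maxSize-twist {D = D} {A = A} dm A⊆
  with W , W∈ , minW ← minSize-attained {D = twist D (ground D ─ A)}
                         (_ , ∈-map⁺ _ (proj₂ (IsDeltaMatroid.nonempty dm)))
  with X , X∈ , refl ← ∈-map⁻ ((ground D ─ A) △_) W∈
  = trans (cong₂ _+_ (maxSize≡ {D = twist D A} (∈-map⁺ (A △_) X∈) X-max) minW) (compl X∈)
  where
  open ≤-Reasoning
  compl : Feasible D Y → ∣ A △ Y ∣ + ∣ (ground D ─ A) △ Y ∣ ≡ ∣ ground D ∣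
  compl {Y = Y} Y∈ = ∣p△q∣+∣r─p△q∣≡∣r∣ A Y (ground D) A⊆ (IsDeltaMatroid.feasible⊆ground dm Y∈)
  X-max : ∀ {V} → Feasible (twist D A) V → ∣ V ∣ ≤ ∣ A △ X ∣
  X-max V∈ with Y , Y∈ , refl ← ∈-map⁻ (A △_) V∈ =
    +-cancelʳ-≤ ∣ (ground D ─ A) △ X ∣ _ _ (begin
      ∣ A △ Y ∣ + ∣ (ground D ─ A) △ X ∣  ≡⟨ cong (∣ A △ Y ∣ +_) minW ⟨
      ∣ A △ Y ∣ + minSize (twist D (ground D ─ A))
        ≤⟨ +-monoʳ-≤ _ (minSize≤ {D = twist D (ground D ─ A)} (∈-map⁺ _ Y∈)) ⟩
      ∣ A △ Y ∣ + ∣ (ground D ─ A) △ Y ∣  ≡⟨ compl Y∈ ⟩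
      ∣ ground D ∣                        ≡⟨ compl X∈ ⟨
      ∣ A △ X ∣ + ∣ (ground D ─ A) △ X ∣  ∎)

-- Circuits, basis exchange and separators.

independent? : (M : SetSystem n) (X : Subset n) → Dec (Independent M X)
independent? M X = map′ List.find (λ (_ , B∈ , X⊆B) → List.lose B∈ X⊆B)
  (Any.any? (X ⊆?_) (feasible M))

dependent⇒circuit : X ⊆ ground M → ¬ Independent M X → ∃[ C ] (Circuit M C × C ⊆ X)
dependent⇒circuit {M = M} = go (⊂-wellFounded _)
  where
  go : Acc _⊂_ X → X ⊆ ground M → ¬ Independent M X → ∃[ C ] (Circuit M C × C ⊆ X)
  go {X} (acc rec) X⊆ dep with any? (λ e → (e ∈? X) ×-dec ¬? (independent? M (X - e)))
  ... | yes (e , e∈X , dep′) =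
    let C , circ , C⊆ = go (rec (x∈p⇒p-x⊂p e∈X)) (X⊆ ∘ x∈p-y⇒x∈p) dep′ in
    C , circ , x∈p-y⇒x∈p ∘ C⊆
  ... | no ¬∃ = X , record
    { ⊆ground   = X⊆
    ; dependent = dep
    ; minimally = λ { (Y⊆X , e , e∈X , e∉Y) →
        let B , B∈ , X-e⊆B = decidable-stable (independent? M (X - e)) λ dep′ → ¬∃ (e , e∈X , dep′) in
        B , B∈ , λ x∈Y → X-e⊆B (x∈p∧x≢y⇒x∈p-y (Y⊆X x∈Y) λ { refl → e∉Y x∈Y }) }
    } , id

BasisExchange : SetSystem n → Set
BasisExchange M = ∀ {X Y u} → Feasible M X → Feasible M Y → u ∈ X → u ∉ Y →
  ∃[ v ] (v ∈ Y × v ∉ X × Feasible M (X △ (⁅ u ⁆ ∪ ⁅ v ⁆)))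

-- Elements of the basis outside `A ∪ B` are exchanged one by one for elements of `B`. No element of
-- `A` is ever removed, and `X ─ (A ∪ B)` shrinks at each exchange.
extend-into : BasisExchange M → Feasible M X → A ⊆ X → Feasible M B →
              ∃[ Y ] (Feasible M Y × A ⊆ Y × Y ⊆ A ∪ B)
extend-into {M = M} {A = A} {B = B} exchange X∈ A⊆X B∈ = go (⊂-wellFounded _) X∈ A⊆X
  where
  go : ∀ {X} → Acc _⊂_ (X ─ (A ∪ B)) → Feasible M X → A ⊆ X →
       ∃[ Y ] (Feasible M Y × A ⊆ Y × Y ⊆ A ∪ B)
  go {X} (acc rec) X∈ A⊆X with nonempty? (X ─ (A ∪ B))
  ... | no ¬∃ = X , X∈ , A⊆X , λ {x} x∈X →
    decidable-stable (x ∈? (A ∪ B)) λ x∉ → ¬∃ (x , x∈p∧x∉q⇒x∈p─q x∈X x∉)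
  ... | yes (u , u∈) =
    let u∈X = p─q⊆p X (A ∪ B) u∈
        u∉A∪B = x∈p─q⇒x∉q X (A ∪ B) u∈
        v , v∈B , v∉X , X′∈ = exchange X∈ B∈ u∈X (u∉A∪B ∘ q⊆p∪q A B)
        uv = ⁅ u ⁆ ∪ ⁅ v ⁆
        u∉X′ = x∈p⇒x∉p△q u∈X (u∈⁅u⁆∪⁅v⁆ u v)
        A⊆X′ : A ⊆ X △ uv
        A⊆X′ x∈A = x∈p△q⁺ˡ (A⊆X x∈A) λ x∈uv →
          [ (λ { refl → u∉A∪B (p⊆p∪q B x∈A) }) , (λ { refl → v∉X (A⊆X x∈A) }) ]′ (x∈⁅u⁆∪⁅v⁆⁻ x∈uv)
        sub : (X △ uv) ─ (A ∪ B) ⊆ X ─ (A ∪ B)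
        sub x∈ = let x∉A∪B = x∈p─q⇒x∉q (X △ uv) (A ∪ B) x∈ in
          case x∈p△q⁻ X uv (p─q⊆p (X △ uv) (A ∪ B) x∈) of λ
            { (inj₁ (x∈X , _)) → x∈p∧x∉q⇒x∈p─q x∈X x∉A∪B
            ; (inj₂ (x∉X , x∈uv)) → ⊥-elim ([ (λ { refl → x∉X u∈X }) , (λ { refl → x∉A∪B (q⊆p∪q A B v∈B) }) ]′ (x∈⁅u⁆∪⁅v⁆⁻ x∈uv)) }
    in go (rec (sub , u , u∈ , λ u∈′ → u∉X′ (p─q⊆p (X △ uv) (A ∪ B) u∈′))) X′∈ A⊆X′

-- If f ∈ C ─ A, exchanging e for f in a basis containing C - f would shrink
-- its intersection with A.
circuit⊆ : BasisExchange M → (∀ {X Y} → Feasible M X → Feasible M Y → ∣ X ∩ A ∣ ≤ ∣ Y ∩ A ∣) →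
           Circuit M C → e ∈ C → e ∈ A → C ⊆ A
circuit⊆ {M = M} {A = A} {C = C} {e = e} exchange constant circ e∈C e∈A {f} f∈C =
  decidable-stable (f ∈? A) λ f∉A →
  let e≢f : e ≢ f
      e≢f = λ { refl → f∉A e∈A }
      B , B∈ , C-f⊆B = minimally (x∈p⇒p-x⊂p f∈C)
      X , X∈ , C-e⊆X = minimally (x∈p⇒p-x⊂p e∈C)
      -- `Y` is the exchanged basis: it contains `C - e`, and its other elements come from `B`.
      Y , Y∈ , C-e⊆Y , Y⊆ = extend-into {M = M} exchange X∈ C-e⊆X B∈
      e∉Y : e ∉ Y
      e∉Y e∈Y = dependent (Y , Y∈ , λ {x} x∈C → case x ≟ e of λ
        { (yes refl) → e∈Y ; (no x≢e) → C-e⊆Y (x∈p∧x≢y⇒x∈p-y x∈C x≢e) })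
      sub : Y ∩ A ⊆ B ∩ A
      sub x∈ = let x∈Y , x∈A = x∈p∩q⁻ Y A x∈ in x∈p∩q⁺
        ([ (λ x∈C-e → C-f⊆B (x∈p∧x≢y⇒x∈p-y (x∈p-y⇒x∈p x∈C-e) λ { refl → f∉A x∈A })) , id ]′
           (x∈p∪q⁻ (C - e) B (Y⊆ x∈Y)) , x∈A)
  in <⇒≱ (p⊂q⇒∣p∣<∣q∣ (sub , e , x∈p∩q⁺ (C-f⊆B (x∈p∧x≢y⇒x∈p-y e∈C e≢f) , e∈A) , e∉Y ∘ proj₁ ∘ x∈p∩q⁻ Y A))
         (constant B∈ Y∈)
  where open Circuit circ

-- `A` itself serves as the set of representatives, since by `circuit⊆` a chain of shared circuits
-- that starts in `A` never leaves it.
constant⇒separator : BasisExchange M → A ⊆ ground M →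
                     (∀ {X Y} → Feasible M X → Feasible M Y → ∣ X ∩ A ∣ ≤ ∣ Y ∩ A ∣) →
                     Separator M A
constant⇒separator {M = M} {A = A} exchange A⊆ constant =
  A , A⊆ , λ x → mk⇔ (λ x∈A → x , x∈A , ε) λ (e , e∈A , e~x) → closed e~x e∈A
  where
  closed : SameComponent M u v → u ∈ A → v ∈ A
  closed ε u∈A = u∈A
  closed (fwd (C , circ , u∈C , w∈C) ◅ w~v) u∈A = closed w~v (circuit⊆ exchange constant circ u∈C u∈A w∈C)
  closed (bwd (C , circ , w∈C , u∈C) ◅ w~v) u∈A = closed w~v (circuit⊆ exchange constant circ u∈C u∈A w∈C)

separator⇒circuit⊆ : Separator M A → Circuit M C → e ∈ C → e ∈ A → C ⊆ A
separator⇒circuit⊆ {e = e} (R , _ , A⇔) circ e∈C e∈A {x} x∈C =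
  let r , r∈R , r~e = Equivalence.to (A⇔ e) e∈A in
  Equivalence.from (A⇔ x) (r , r∈R , r~e ◅◅ (fwd (_ , circ , e∈C , x∈C) ◅ ε))

-- If `Y` met `A` in fewer elements than `X`, then `X` inside `A` together with `Y` outside `A`
-- would exceed the size of a basis and so contain a circuit. The separator keeps this circuit
-- within `A` or disjoint from it, hence inside the basis `X` or the basis `Y`, which is absurd.
separator⇒constant : (∀ {X} → Feasible M X → X ⊆ ground M) →
                     (∀ {X Y} → Feasible M X → Feasible M Y → ∣ X ∣ ≡ ∣ Y ∣) → Separator M A →
                     ∀ {X Y} → Feasible M X → Feasible M Y → ∣ X ∩ A ∣ ≤ ∣ Y ∩ A ∣
separator⇒constant {M = M} {A = A} ⊆ground equicardinal sep {X} {Y} X∈ Y∈ = ≮⇒≥ λ Y<X →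
  let Z = (X ∩ A) ∪ (Y ─ A)
      Z⊆ : Z ⊆ ground M
      Z⊆ x∈ = [ ⊆ground X∈ ∘ proj₁ ∘ x∈p∩q⁻ X A , ⊆ground Y∈ ∘ p─q⊆p Y A ]′ (x∈p∪q⁻ (X ∩ A) (Y ─ A) x∈)
      Y<Z : ∣ Y ∣ < ∣ Z ∣
      Y<Z = begin-strict
        ∣ Y ∣                  ≡⟨ ∣p∩q∣+∣p─q∣≡∣p∣ Y A ⟨
        ∣ Y ∩ A ∣ + ∣ Y ─ A ∣  <⟨ +-monoˡ-< _ Y<X ⟩
        ∣ X ∩ A ∣ + ∣ Y ─ A ∣  ≡⟨ ∣p∩q∪r─q∣≡∣p∩q∣+∣r─q∣ X A Y ⟨
        ∣ Z ∣                  ∎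
      dep : ¬ Independent M Z
      dep = λ (B , B∈ , Z⊆B) → <⇒≱ Y<Z (≤-trans (p⊆q⇒∣p∣≤∣q∣ Z⊆B) (≤-reflexive (equicardinal B∈ Y∈)))
      C , circ , C⊆Z = dependent⇒circuit {M = M} Z⊆ dep
      open Circuit circ
  in case nonempty? (C ∩ A) of λ
    { (yes (e , e∈)) →
        let e∈C , e∈A = x∈p∩q⁻ C A e∈
            C⊆A = separator⇒circuit⊆ {M = M} sep circ e∈C e∈A
        in dependent (X , X∈ , λ x∈C →
          [ proj₁ ∘ x∈p∩q⁻ X A , (λ x∈ → contradiction (C⊆A x∈C) (x∈p─q⇒x∉q Y A x∈)) ]′
            (x∈p∪q⁻ (X ∩ A) (Y ─ A) (C⊆Z x∈C)))
    ; (no C∩A=∅) → dependent (Y , Y∈ , λ x∈C →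
          [ (λ x∈ → contradiction (_ , x∈p∩q⁺ (x∈C , proj₂ (x∈p∩q⁻ X A x∈))) C∩A=∅) , p─q⊆p Y A ]′
            (x∈p∪q⁻ (X ∩ A) (Y ─ A) (C⊆Z x∈C))) }
  where open ≤-Reasoning

-- Basis exchange among the feasible sets of minimum size.

∈-minimal⁺ : Feasible D X → ∣ X ∣ ≡ minSize D → Feasible (minimal D) X
∈-minimal⁺ {D = D} = ∈-filter⁺ λ X → ∣ X ∣ ℕ.≟ minSize D

∈-minimal⁻ : Feasible (minimal D) X → Feasible D X × ∣ X ∣ ≡ minSize D
∈-minimal⁻ {D = D} = ∈-filter⁻ λ X → ∣ X ∣ ℕ.≟ minSize D

-- If the symmetric exchange returned some `v` in `X`, it would only remove elements and leave a
-- feasible set below the minimum size. So `v` comes from `Y`, and the new set does not grow.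
minimal-basisExchange : IsDeltaMatroid D → BasisExchange (minimal D)
minimal-basisExchange {D = D} dm {X} {Y} {u} X∈ Y∈ u∈X u∉Y
  with X∈D , ∣X∣ ← ∈-minimal⁻ {D = D} X∈ | Y∈D , _ ← ∈-minimal⁻ {D = D} Y∈
  with v , v∈ , Z∈ ← IsDeltaMatroid.exchange dm X∈D Y∈D (x∈p△q⁺ˡ u∈X u∉Y)
  with x∈p△q⁻ X Y v∈
... | inj₂ (v∉X , v∈Y) = v , v∈Y , v∉X , ∈-minimal⁺ {D = D} Z∈
        (≤-antisym (≤-trans (∣p△uv∣≤∣p∣ v u∈X) (≤-reflexive ∣X∣)) (minSize≤ {D = D} Z∈))
... | inj₁ (v∈X , _) = contradiction (minSize≤ {D = D} Z∈)
        (<⇒≱ (subst (∣ X △ (⁅ u ⁆ ∪ ⁅ v ⁆) ∣ <_) ∣X∣ (p⊂q⇒∣p∣<∣q∣ (sub , u , u∈X , x∈p⇒x∉p△q u∈X (u∈⁅u⁆∪⁅v⁆ u v)))))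
  where
  sub : X △ (⁅ u ⁆ ∪ ⁅ v ⁆) ⊆ X
  sub x∈ = case x∈p△q⁻ X (⁅ u ⁆ ∪ ⁅ v ⁆) x∈ of λ
    { (inj₁ (x∈X , _)) → x∈X
    ; (inj₂ (_ , x∈uv)) → [ (λ { refl → u∈X }) , (λ { refl → v∈X }) ]′ (x∈⁅u⁆∪⁅v⁆⁻ x∈uv) }

-- The width of a twist.

-- Here `w`, `m`, `M` are the width and extreme sizes of the twist by `A`, and `m̄` is the minimum
-- size of the twist by the complement. The sizes of `A` and its complement are `a` and `ā`; `wᵢ`,
-- `mᵢ` are width and minimum size of the two restrictions, whose costs are `d` and `c`.
width-arithmetic : ∀ {w m M m̄ a ā c d w₁ m₁ w₂ m₂} l →
  w + m ≡ M → M + m̄ ≡ a + ā →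
  m + (w₁ + m₁) ≡ a + d → m̄ + (w₂ + m₂) ≡ ā + c →
  m₁ + d ≡ m₂ + c → m₁ ≡ c + l →
  w ≡ w₁ + w₂ + (l + l)
width-arithmetic {w} {m} {_} {m̄} {a} {ā} {c} {d} {w₁} {_} {w₂} {m₂} l refl eq₁ eq₂ eq₃ eq₄ refl =
  -- Both sides are padded so that the equations can be added without subtraction.
  +-cancelʳ-≡ (m + m̄ + (d + c)) _ _ (begin
    w + (m + m̄ + (d + c))                        ≡⟨ lemma₁ w m m̄ (d + c) ⟩
    w + m + m̄ + (d + c)                          ≡⟨ cong (_+ (d + c)) eq₁ ⟩
    a + ā + (d + c)                              ≡⟨ lemma₂ a ā d c ⟩
    (a + d) + (ā + c)                            ≡⟨ cong₂ _+_ eq₂ eq₃ ⟨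
    (m + (w₁ + (c + l))) + (m̄ + (w₂ + m₂))       ≡⟨ cong (λ k → (m + (w₁ + (c + l))) + (m̄ + (w₂ + k))) m₂≡l+d ⟩
    (m + (w₁ + (c + l))) + (m̄ + (w₂ + (l + d)))  ≡⟨ lemma₃ m w₁ c l m̄ w₂ d ⟩
    w₁ + w₂ + (l + l) + (m + m̄ + (d + c))        ∎)
  where
  open ≡-Reasoning
  lemma₁ : ∀ w m m̄ k → w + (m + m̄ + k) ≡ w + m + m̄ + k
  lemma₁ = solve-∀
  lemma₂ : ∀ a ā d c → a + ā + (d + c) ≡ (a + d) + (ā + c)
  lemma₂ = solve-∀
  lemma₃ : ∀ m w₁ c l m̄ w₂ d →
           (m + (w₁ + (c + l))) + (m̄ + (w₂ + (l + d))) ≡ w₁ + w₂ + (l + l) + (m + m̄ + (d + c))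
  lemma₃ = solve-∀
  lemma₄ : ∀ c l d → c + l + d ≡ l + d + c
  lemma₄ = solve-∀
  -- The connectivity is symmetric: `m₂` exceeds `d` by the same `l` by which `m₁` exceeds `c`.
  m₂≡l+d : m₂ ≡ l + d
  m₂≡l+d = +-cancelʳ-≡ c _ _ (trans (sym eq₄) (lemma₄ c l d))

restrict-isDeltaMatroid : IsDeltaMatroid D → ∀ A → IsDeltaMatroid (restrict D A)
restrict-isDeltaMatroid {D = D} dm A = deleteAll-isDeltaMatroid dm (elements (ground D ─ A))

restrict-projection : IsDeltaMatroid D → ∀ A → Projection D (restrict D A)
restrict-projection {D = D} dm A = deleteAll-projection dm (elements (ground D ─ A))

module _ (D : SetSystem n) (A : Subset n) (dm : IsDeltaMatroid D) (A⊆ : A ⊆ ground D) where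
  open IsDeltaMatroid dm

  private
    Ā : Subset n
    Ā = ground D ─ A

    D₁ D₂ : SetSystem n
    D₁ = restrict D A
    D₂ = restrict D Ā

    dm₁ : IsDeltaMatroid D₁
    dm₁ = restrict-isDeltaMatroid dm A

    dm₂ : IsDeltaMatroid D₂
    dm₂ = restrict-isDeltaMatroid dm Ā

    π₁ : Projection D D₁
    π₁ = restrict-projection dm A

    π₂ : Projection D D₂
    π₂ = restrict-projection dm Ā

    -- Each projection deletes the side that it does not keep, so `c₂` is c(A) and `c₁` is c(Ā).
    c₁ c₂ : ℕ
    c₁ = Projection.cost π₁
    c₂ = Projection.cost π₂

    ground₁ : ground D₁ ≡ A
    ground₁ = ground-restrict D A⊆

    ground₂ : ground D₂ ≡ Ā
    ground₂ = ground-restrict D (p─q⊆p (ground D) A)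

    minSize₁ : minSize D ≡ minSize D₁ + c₁
    minSize₁ = minSize-projection dm dm₁ π₁

    minSize₂ : minSize D ≡ minSize D₂ + c₂
    minSize₂ = minSize-projection dm dm₂ π₂

    X─Ā≡X∩A : Feasible D X → X ─ Ā ≡ X ∩ A
    X─Ā≡X∩A X∈ = p─[r─q]≡p∩q _ A (ground D) (feasible⊆ground X∈)

    c₁≤∣X─A∣ : Feasible D X → c₁ ≤ ∣ X ─ A ∣
    c₁≤∣X─A∣ {X} X∈ = subst (λ G → c₁ ≤ ∣ X ─ G ∣) ground₁ (cost≤∣Y─ground∣ dm dm₁ π₁ X∈)

    c₂≤∣X∩A∣ : Feasible D X → c₂ ≤ ∣ X ∩ A ∣
    c₂≤∣X∩A∣ {X} X∈ = subst (λ p → c₂ ≤ ∣ p ∣)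
      (trans (cong (X ─_) ground₂) (X─Ā≡X∩A X∈)) (cost≤∣Y─ground∣ dm dm₂ π₂ X∈)

    -- At fixed size, a basis with the fewest elements outside `A` has the most inside it.
    basis₁ : ∃[ X ] (Feasible (minimal D) X × ∣ X ∩ A ∣ ≡ minSize D₁)
    basis₁ =
      let X , X∈ , ∣X∣ , ∣X─A∣ = lift-minSize dm dm₁ π₁
      in X , ∈-minimal⁺ {D = D} X∈ ∣X∣ , +-cancelʳ-≡ c₁ _ _ (begin
        ∣ X ∩ A ∣ + c₁                  ≡⟨ cong (∣ X ∩ A ∣ +_) ∣X─A∣ ⟨
        ∣ X ∩ A ∣ + ∣ X ─ ground D₁ ∣   ≡⟨ cong (λ G → ∣ X ∩ A ∣ + ∣ X ─ G ∣) ground₁ ⟩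
        ∣ X ∩ A ∣ + ∣ X ─ A ∣           ≡⟨ ∣p∩q∣+∣p─q∣≡∣p∣ X A ⟩
        ∣ X ∣                           ≡⟨ trans ∣X∣ minSize₁ ⟩
        minSize D₁ + c₁                 ∎)
      where open ≡-Reasoning

    basis₂ : ∃[ X ] (Feasible (minimal D) X × ∣ X ∩ A ∣ ≡ c₂)
    basis₂ =
      let X , X∈ , ∣X∣ , ∣X─Ā∣ = lift-minSize dm dm₂ π₂
      in X , ∈-minimal⁺ {D = D} X∈ ∣X∣ ,
         trans (cong ∣_∣ (trans (sym (X─Ā≡X∩A X∈)) (cong (X ─_) (sym ground₂)))) ∣X─Ā∣

    -- This makes the truncated subtraction in `connectivity` exact.
    c₂≤minSize₁ : c₂ ≤ minSize D₁
    c₂≤minSize₁ = let _ , X∈ , ∣X∩A∣ = basis₁ in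
      subst (c₂ ≤_) ∣X∩A∣ (c₂≤∣X∩A∣ (proj₁ (∈-minimal⁻ {D = D} X∈)))

    ∣X∩A∣≤minSize₁ : Feasible (minimal D) X → ∣ X ∩ A ∣ ≤ minSize D₁
    ∣X∩A∣≤minSize₁ {X} X∈ = let X∈D , ∣X∣ = ∈-minimal⁻ {D = D} X∈ in
      +-cancelʳ-≤ c₁ _ _ (begin
        ∣ X ∩ A ∣ + c₁         ≤⟨ +-monoʳ-≤ _ (c₁≤∣X─A∣ X∈D) ⟩
        ∣ X ∩ A ∣ + ∣ X ─ A ∣  ≡⟨ ∣p∩q∣+∣p─q∣≡∣p∣ X A ⟩
        ∣ X ∣                  ≡⟨ trans ∣X∣ minSize₁ ⟩
        minSize D₁ + c₁        ∎)
      where open ≤-Reasoning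

  -- With r the rank function of minimal D: minSize D₁ = r(A) and c₂ = r(E) - r(Ā).
  connectivity : ℕ
  connectivity = minSize D₁ ∸ c₂

  -- `basis₁` and `basis₂` attain the two extreme intersections with `A`, so constancy makes the
  -- extremes coincide.
  separator⇒connectivity≡0 : Separator (minimal D) A → connectivity ≡ 0
  separator⇒connectivity≡0 sep =
    let X , X∈ , ∣X∩A∣ = basis₁
        Y , Y∈ , ∣Y∩A∣ = basis₂
    in m≤n⇒m∸n≡0 (subst₂ _≤_ ∣X∩A∣ ∣Y∩A∣ (separator⇒constant {M = minimal D}
         (feasible⊆ground ∘ proj₁ ∘ ∈-minimal⁻ {D = D})
         (λ X∈ Y∈ → trans (proj₂ (∈-minimal⁻ {D = D} X∈)) (sym (proj₂ (∈-minimal⁻ {D = D} Y∈))))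
         sep X∈ Y∈))

  connectivity≡0⇒separator : connectivity ≡ 0 → Separator (minimal D) A
  connectivity≡0⇒separator λ≡0 = constant⇒separator {M = minimal D} (minimal-basisExchange dm) A⊆
    λ X∈ Y∈ → ≤-trans (∣X∩A∣≤minSize₁ X∈)
      (≤-trans (m∸n≡0⇒m≤n λ≡0) (c₂≤∣X∩A∣ (proj₁ (∈-minimal⁻ {D = D} Y∈))))

  width-twist : width (twist D A) ≡ width D₁ + width D₂ + (connectivity + connectivity)
  width-twist = width-arithmetic connectivity
    (width+minSize≡maxSize {D = twist D A} (_ , ∈-map⁺ (A △_) (proj₂ nonempty)))
    (trans (maxSize-twist dm A⊆) (sym (p⊆q⇒∣p∣+∣q─p∣≡∣q∣ A (ground D) A⊆)))
    (trans (cong (minSize (twist D A) +_) (width+minSize≡maxSize {D = D₁} (IsDeltaMatroid.nonempty dm₁)))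
           (minSize-twist dm dm₁ π₁ ground₁))
    (trans (cong (minSize (twist D Ā) +_) (width+minSize≡maxSize {D = D₂} (IsDeltaMatroid.nonempty dm₂)))
           (minSize-twist dm dm₂ π₂ ground₂))
    (trans (sym minSize₁) minSize₂)
    (sym (m+[n∸m]≡n c₂≤minSize₁))

-- Twists of width one.

i+j+2k≡1 : ∀ i j k → i + j + (k + k) ≡ 1 → k ≡ 0 × ((i ≡ 0 × j ≡ 1) ⊎ (j ≡ 0 × i ≡ 1))
i+j+2k≡1 0 1 0 _ = refl , inj₁ (refl , refl)
i+j+2k≡1 1 0 0 _ = refl , inj₂ (refl , refl)
-- A positive connectivity counts twice and already pushes the sum beyond one.
i+j+2k≡1 i j (suc k) eq = contradiction (trans (sym (lemma i j k)) eq) λ ()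
  where
  lemma : ∀ i j k → i + j + (suc k + suc k) ≡ suc (suc (i + j + (k + k)))
  lemma = solve-∀
i+j+2k≡1 0 (suc (suc j)) 0 ()
i+j+2k≡1 1 (suc j) 0 ()
i+j+2k≡1 (suc (suc i)) j 0 ()

theorem2p3 : ∀ (n : ℕ) (D : SetSystem n) (A : Subset n) →
    IsDeltaMatroid D → A ⊆ ground D →
    let Ā = ground D ─ A in
    width (twist D A) ≡ 1
    ⇔ (Separator (minimal D) A
    × ((IsMatroid (restrict D A) × width (restrict D Ā) ≡ 1)
    ⊎ (IsMatroid (restrict D Ā) × width (restrict D A) ≡ 1)))
theorem2p3 n D A dm A⊆ = mk⇔ to from
  where
  Ā = ground D ─ A
  D₁ = restrict D A
  D₂ = restrict D Ā
  w≡ = width-twist D A dm A⊆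

  to : width (twist D A) ≡ 1 →
       Separator (minimal D) A × ((IsMatroid D₁ × width D₂ ≡ 1) ⊎ (IsMatroid D₂ × width D₁ ≡ 1))
  to w≡1 =
    let λ≡0 , widths = i+j+2k≡1 (width D₁) (width D₂) (connectivity D A dm A⊆) (trans (sym w≡) w≡1)
    in connectivity≡0⇒separator D A dm A⊆ λ≡0 ,
       Sum.map (λ (w₁≡0 , w₂≡1) → width≡0⇒isMatroid (restrict-isDeltaMatroid dm A) w₁≡0 , w₂≡1)
               (λ (w₂≡0 , w₁≡1) → width≡0⇒isMatroid (restrict-isDeltaMatroid dm Ā) w₂≡0 , w₁≡1)
               widths

  from : Separator (minimal D) A × ((IsMatroid D₁ × width D₂ ≡ 1) ⊎ (IsMatroid D₂ × width D₁ ≡ 1)) →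
         width (twist D A) ≡ 1
  from (sep , inj₁ (M₁ , w₂≡1)) = trans w≡ (cong₂ _+_
    (cong₂ _+_ (isMatroid⇒width≡0 M₁) w₂≡1) (cong (λ k → k + k) (separator⇒connectivity≡0 D A dm A⊆ sep)))
  from (sep , inj₂ (M₂ , w₁≡1)) = trans w≡ (cong₂ _+_
    (cong₂ _+_ w₁≡1 (isMatroid⇒width≡0 M₂)) (cong (λ k → k + k) (separator⇒connectivity≡0 D A dm A⊆ sep)))
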